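{- Let $n,k$ be integers with $1\le k\le \frac n2-1$, and let $T\in\mathcal T_{n,k}$. Put $\Delta=\left\lfloor \frac{n-2}{k}\right\rfloor+1$, $p=\left\lfloor \frac{n-2-k(\Delta-1)}{\Delta-2}\right\rfloor$ and $\mu=n-1-k(\Delta-1)-p(\Delta-2)$. Then $$\prod\nolimits_2(T)\ \le\ \Delta^{k\Delta}(\Delta-1)^{p(\Delta-1)}\mu^{\mu},$$ and equality holds if and only if the degree sequence of $T$ is $$(\underbrace{\Delta,\ldots,\Delta}_{k},\underbrace{\Delta-1,\ldots,\Delta-1}_{p},\mu,\underbrace{1,\ldots,1}_{n-k-p-1}).$$
   Context: All graphs are finite, simple, connected and undirected; $d(v)$ denotes the degree of a vertex $v$. $\mathcal T_{n,k}$ is the class of trees with $n$ vertices in which exactly $k$ vertices have degree equal to the maximum vertex degree of the tree. The second multiplicative Zagreb index of a graph $G$ is $\prod_2(G)=\prod_{uv\in E(G)}d(u)d(v)=\prod_{u\in V(G)}d(u)^{d(u)}$. The degree sequence of a graph is the list of its vertex degrees in non-increasing order. -}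

module Defs where

open import Data.Fin.Base using (Fin)
open import Data.Fin.Properties using (_<?_)
open import Data.List.Base using (List; _∷_; _∷ʳ_; allFin; cartesianProduct; filter; length; map)
open import Data.List.Extrema.Nat using (max)
open import Data.List.Relation.Unary.Linked using (Linked)
open import Data.List.Relation.Unary.Unique.Propositional using (Unique)
open import Data.Nat.Base using (ℕ; NonZero; >-nonZero; _+_; _*_; _∸_; _≤_; z≤n; s≤s)
open import Data.Nat.ListAction using (product)
open import Data.Nat.DivMod using (_/_; m*n/n≡m; /-monoˡ-≤)
open import Data.Nat.Properties using (_≟_; ≤-decTotalOrder; ≤-trans; ≤-reflexive; ∸-monoˡ-≤; m+n∸n≡m; +-comm; *-distribˡ-+)
open import Data.Product.Base using (_×_; _,_; uncurry)
open import Level using (0ℓ)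
open import Relation.Binary.Core using (Rel)
open import Relation.Binary.Construct.Closure.ReflexiveTransitive using (Star)
open import Relation.Binary.Definitions using (Decidable; Symmetric)
open import Relation.Binary.PropositionalEquality.Core using (_≡_; sym; trans; cong)
open import Relation.Nullary using (¬_)
open import Relation.Nullary.Decidable using (_×-dec_)
import Data.List.Sort
import Relation.Binary.Construct.Flip.EqAndOrd as Flip

-- Finite simple graphs on the vertex set Fin n.
record SimpleGraph (n : ℕ) : Set₁ where
  infix 4 _~_ _~?_
  field
    _~_      : Rel (Fin n) 0ℓ
    _~?_     : Decidable _~_
    ~-sym    : Symmetric _~_
    ~-irrefl : ∀ v → ¬ (v ~ v)

module _ {n : ℕ} (G : SimpleGraph n) where
  open SimpleGraph G

  degree : Fin n → ℕ
  degree v = length (filter (v ~?_) (allFin n))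

  degrees : List ℕ
  degrees = map degree (allFin n)

  maxDegree : ℕ
  maxDegree = max 0 degrees

  -- Each undirected edge is listed once, as the pair (u , v) with u < v.
  edges : List (Fin n × Fin n)
  edges = filter (uncurry λ u v → (u <? v) ×-dec (u ~? v))
                 (cartesianProduct (allFin n) (allFin n))

  Π₂ : ℕ
  Π₂ = product (map (uncurry λ u v → degree u * degree v) edges)

  -- Sorting with respect to _≥_ gives the non-increasing order.
  degreeSequence : List ℕ
  degreeSequence = Data.List.Sort.sort (Flip.decTotalOrder ≤-decTotalOrder) degrees

  Connected : Set
  Connected = ∀ u v → Star _~_ u v

  -- The closed walk u, vs, u is a cycle: at least three vertices, none repeated
  -- except for the return to u.
  IsCycle : Fin n → List (Fin n) → Set
  IsCycle u vs = 2 ≤ length vs × Unique (u ∷ vs) × Linked _~_ (u ∷ vs ∷ʳ u)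

  Acyclic : Set
  Acyclic = ∀ u vs → ¬ IsCycle u vs

  IsTree : Set
  IsTree = Connected × Acyclic

-- The class 𝒯ₙ,ₖ.
record 𝒯 (n k : ℕ) : Set₁ where
  field
    graph      : SimpleGraph n
    isTree     : IsTree graph
    #maxDegree : length (filter (λ v → degree graph v ≟ maxDegree graph) (allFin n)) ≡ k

-- The parameters Δ, p and μ.  The range of k is needed for the divisors k and
-- Δ ∸ 2 to be nonzero; in that range none of the subtractions below truncates.
module Parameters (n k : ℕ) (1≤k : 1 ≤ k) (2k+2≤n : 2 * (k + 1) ≤ n) where

  private instance
    k≢0 : NonZero k
    k≢0 = >-nonZero 1≤k

  Δ : ℕ
  Δ = (n ∸ 2) / k + 1

  private
    2≤q⇒Δ∸2≢0 : ∀ {q} → 2 ≤ q → NonZero (q + 1 ∸ 2)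
    2≤q⇒Δ∸2≢0 (s≤s (s≤s {n = r} z≤n)) = >-nonZero (≤-trans (s≤s z≤n) (≤-reflexive (+-comm 1 r)))

    2k≤n∸2 : 2 * k ≤ n ∸ 2
    2k≤n∸2 = ≤-trans
      (≤-reflexive (sym (trans (cong (_∸ 2) (*-distribˡ-+ 2 k 1)) (m+n∸n≡m (2 * k) 2))))
      (∸-monoˡ-≤ 2 2k+2≤n)

    2≤q : 2 ≤ (n ∸ 2) / k
    2≤q = ≤-trans (≤-reflexive (sym (m*n/n≡m 2 k))) (/-monoˡ-≤ k 2k≤n∸2)

  instance
    Δ∸2≢0 : NonZero (Δ ∸ 2)
    Δ∸2≢0 = 2≤q⇒Δ∸2≢0 2≤q

  p : ℕ
  p = (n ∸ 2 ∸ k * (Δ ∸ 1)) / (Δ ∸ 2)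

  μ : ℕ
  μ = n ∸ 1 ∸ k * (Δ ∸ 1) ∸ p * (Δ ∸ 2)

{-# OPTIONS --safe #-}

-- Write e = d − 1 for each vertex of degree d.  A tree on n vertices has Σ e = n − 2 (only
-- Σ e ≤ n − 2 is needed), and Π₂ = ∏ w(e) with w(e) = (e + 1)^(e + 1) strictly log-convex.
-- By log-convexity two entries are best merged, into their sum and a zero, or into the largest
-- admissible value m and the excess; so the best product over entries ≤ m is attained by filling
-- up copies of m.  Applied with m = Δ − 2 to the n − k vertices that are not of maximum degree,
-- this gives the bound when the maximum degree is Δ.  When it is smaller, all n entries are ≤ m,
-- and trading the parts m for k entries m + 1 strictly increases the product.
module Submission where

open import Data.Bool.Base using (Bool; _∧_; if_then_else_)
open import Data.Fin.Base using (Fin; zero; suc)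
import Data.Fin.Base as Fin
import Data.Fin.Properties as Fin
open import Data.List.Base using (List; []; _∷_; _++_; [_]; _∷ʳ_; allFin; cartesianProduct; filter; length; lookup; map; replicate)
open import Data.List.Extrema.Nat using (xs≤max)
import Data.List.Membership.DecPropositional as DecMembership
open import Data.List.Membership.Propositional using (_∈_; find)
open import Data.List.Membership.Propositional.Properties using (∈-∃++; ∈-lookup; ∈-filter⁻; ∈-filter⁺; ∈-allFin; ∈-length)
open import Data.List.Properties using (++-assoc; ++-identityʳ; ∷ʳ-++; filter-reject; length-++; length-map; length-replicate; length-tabulate; map-++; map-∘; map-cong; map-replicate; partition-defn)
open import Data.List.Relation.Binary.Permutation.Propositional using (_↭_; ↭-refl; ↭-reflexive; ↭-sym; ↭-trans; prep; swap; ↭⇒↭ₛ; ↭ₛ⇒↭; module PermutationReasoning)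
open import Data.List.Relation.Binary.Permutation.Propositional.Properties using (++⁺ˡ; ++⁺ʳ; drop-∷; filter-↭; shift; ∷↭∷ʳ; ↭-length)
import Data.List.Relation.Binary.Permutation.Propositional.Properties as ↭
import Data.List.Relation.Binary.Permutation.Setoid.Properties as ↭ₛ
open import Data.List.Relation.Binary.Pointwise using (Pointwise-≡⇒≡)
open import Data.List.Relation.Unary.All as All using (All; []; _∷_)
import Data.List.Relation.Unary.All.Properties as All
open import Data.List.Relation.Unary.AllPairs as AllPairs using (AllPairs; []; _∷_)
import Data.List.Relation.Unary.AllPairs.Properties as AllPairs
open import Data.List.Relation.Unary.Any using (here; there)
open import Data.List.Relation.Unary.Linked using (Linked; [-]; _∷_)
import Data.List.Relation.Unary.Linked.Properties as Linked
import Data.List.Relation.Unary.Sorted.TotalOrder.Properties as Sorted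
open import Data.List.Relation.Unary.Unique.Propositional using (Unique)
import Data.List.Relation.Unary.Unique.Propositional.Properties as Unique
import Data.List.Sort
open import Data.Nat.Base
open import Data.Nat.Divisibility using (divides-refl)
open import Data.Nat.DivMod
open import Data.Nat.ListAction using (sum; product)
open import Data.Nat.ListAction.Properties using (product-++; product-↭; sum-++; sum-↭)
open import Data.Nat.Properties
open import Data.Nat.Tactic.RingSolver using (solve-∀)
open import Data.Product.Base using (_×_; _,_; ∃₂; ∃-syntax; proj₁; proj₂; uncurry)
open import Data.Sum.Base using (_⊎_; inj₁; inj₂)
open import Function.Base using (_∘_)
open import Function.Bundles using (_⇔_; mk⇔)
open import Level using (0ℓ)
open import Relation.Binary.Construct.Closure.ReflexiveTransitive using (Star; ε; _◅_)
import Relation.Binary.Construct.Flip.EqAndOrd as Flip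
open import Relation.Binary.Core using (Rel)
open import Relation.Binary.Definitions using (tri<; tri≈; tri>)
open import Relation.Binary.PropositionalEquality using (_≡_; _≢_; refl; sym; trans; cong; cong₂; subst; subst₂; ≢-sym; setoid; module ≡-Reasoning)
open import Relation.Nullary using (Dec; contradiction; yes; no; does)
open import Relation.Unary using (Pred; Decidable)
open import Relation.Unary.Properties using (∁?)
open import Defs

-- Repetition-free lists, paths and permutations

module _ {A : Set} where

  Unique⇒lookup-injective : ∀ {xs : List A} → Unique xs → ∀ {i j} → lookup xs i ≡ lookup xs j → i ≡ j
  Unique⇒lookup-injective (_    ∷ _)  {zero}  {zero}  _  = refl
  Unique⇒lookup-injective (x∉xs ∷ _)  {zero}  {suc j} eq = contradiction eq (All.lookup x∉xs (∈-lookup j))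
  Unique⇒lookup-injective (x∉xs ∷ _)  {suc i} {zero}  eq = contradiction (sym eq) (All.lookup x∉xs (∈-lookup i))
  Unique⇒lookup-injective (_    ∷ !xs) {suc i} {suc j} eq = cong suc (Unique⇒lookup-injective !xs eq)

  Unique-++⁻ˡ : ∀ (xs : List A) {ys} → Unique (xs ++ ys) → Unique xs
  Unique-++⁻ˡ []       _             = []
  Unique-++⁻ˡ (x ∷ xs) (x∉ ∷ !xs++ys) = All.++⁻ˡ xs x∉ ∷ Unique-++⁻ˡ xs !xs++ys

  Linked-cut : ∀ {R : Rel A 0ℓ} {x y z} ys {zs} → Linked R (x ∷ ys ++ y ∷ zs) → R y z → Linked R (x ∷ (ys ∷ʳ y) ∷ʳ z)
  Linked-cut []       (Rxy ∷ _)  Ryz = Rxy ∷ Ryz ∷ [-]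
  Linked-cut (_ ∷ ys) (Rxy ∷ Rs) Ryz = Rxy ∷ Linked-cut ys Rs Ryz

  ∈⇒↭ : ∀ {x} {xs : List A} → x ∈ xs → ∃[ ys ] xs ↭ x ∷ ys
  ∈⇒↭ {x} x∈xs with ys , zs , refl ← ∈-∃++ x∈xs = ys ++ zs , shift x ys zs

  Unique-resp-↭ : ∀ {xs ys : List A} → xs ↭ ys → Unique xs → Unique ys
  Unique-resp-↭ = ↭ₛ.Unique-resp-↭ (setoid A) ∘ ↭⇒↭ₛ

Unique-length-≤ : ∀ {n} {xs : List (Fin n)} → Unique xs → length xs ≤ n
Unique-length-≤ !xs = Fin.injective⇒≤ (Unique⇒lookup-injective !xs)

-- Acyclic graphs

module Forest {n : ℕ} (G : SimpleGraph n) where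
  open SimpleGraph G
  open DecMembership (Fin._≟_ {n}) using (_∈?_)

  degreeIn : List (Fin n) → Fin n → ℕ
  degreeIn xs v = length (filter (v ~?_) xs)

  degreeSum : List (Fin n) → ℕ
  degreeSum xs = sum (map (degreeIn xs) xs)

  degreeIn-∷-self : ∀ v ws → degreeIn (v ∷ ws) v ≡ degreeIn ws v
  degreeIn-∷-self v ws = cong length (filter-reject (v ~?_) (~-irrefl v))

  degreeIn-↭ : ∀ {xs ys} → xs ↭ ys → ∀ v → degreeIn xs v ≡ degreeIn ys v
  degreeIn-↭ p v = ↭-length (filter-↭ (v ~?_) p)

  degreeSum-↭ : ∀ {xs ys} → xs ↭ ys → degreeSum xs ≡ degreeSum ys
  degreeSum-↭ {xs} {ys} p = trans (sum-↭ (↭.map⁺ (degreeIn xs) p)) (cong sum (map-cong (degreeIn-↭ p) ys))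

  -- Each edge at `v` is counted once at `v` and once at its other end. This is the effect of
  -- deleting a vertex in the induction of `degreeSum-≤`.
  degreeSum-∷ : ∀ v ws → degreeSum (v ∷ ws) ≡ 2 * degreeIn ws v + degreeSum ws
  degreeSum-∷ v ws = trans (cong₂ _+_ (degreeIn-∷-self v ws) (others ws)) (double (degreeIn ws v) (degreeSum ws))
    where
    double : ∀ d s → d + (d + s) ≡ 2 * d + s
    double = solve-∀
    both : ∀ c d s → suc c + (d + s) ≡ suc (d + (c + s))
    both = solve-∀
    swap-+ : ∀ c d s → c + (d + s) ≡ d + (c + s)
    swap-+ = solve-∀
    others : ∀ us → sum (map (degreeIn (v ∷ ws)) us) ≡ degreeIn us v + sum (map (degreeIn ws) us)
    others []       = refl
    others (u ∷ us) with u ~? v | v ~? u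
    ... | yes _   | yes _   = trans (cong (suc (degreeIn ws u) +_) (others us)) (both (degreeIn ws u) (degreeIn us v) _)
    ... | no _    | no _    = trans (cong (degreeIn ws u +_) (others us)) (swap-+ (degreeIn ws u) (degreeIn us v) _)
    ... | yes u~v | no v≁u  = contradiction (~-sym u~v) v≁u
    ... | no u≁v  | yes v~u = contradiction (~-sym v~u) u≁v

  -- Two distinct neighbours cannot both equal `u`. With `u` the previous vertex of a path, this
  -- gives a continuation that does not turn back.
  neighbour-≢ : ∀ {xs v} → Unique xs → 2 ≤ degreeIn xs v → ∀ u → ∃[ x ] x ∈ xs × v ~ x × x ≢ u
  neighbour-≢ {xs} {v} !xs 2≤d u = choose (Unique.filter⁺ (v ~?_) !xs) (λ x∈ → ∈-filter⁻ (v ~?_) x∈) 2≤d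
    where
    choose : ∀ {zs} → Unique zs → (∀ {x} → x ∈ zs → x ∈ xs × v ~ x) → 2 ≤ length zs → ∃[ x ] x ∈ xs × v ~ x × x ≢ u
    choose {y ∷ z ∷ _} ((y≢z ∷ _) ∷ _) zs⊆ _ with y Fin.≟ u
    ... | no y≢u   = let y∈ , v~y = zs⊆ (here refl) in y , y∈ , v~y , y≢u
    ... | yes refl = let z∈ , v~z = zs⊆ (there (here refl)) in z , z∈ , v~z , ≢-sym y≢z
    choose {_ ∷ []} _ _ (s≤s ())

  -- Paths grow at the head, so `h` is the newest vertex. As `w` lies beyond `p`, cutting the path
  -- off after `w` and returning to `h` leaves at least three vertices.
  chord⇒cycle : ∀ {h p w ps} → Unique (h ∷ p ∷ ps) → Linked _~_ (h ∷ p ∷ ps) → w ∈ ps → h ~ w → ∃[ vs ] IsCycle G h vs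
  chord⇒cycle {h} {p} {w} !path path w∈ps h~w with ys , zs , refl ← ∈-∃++ w∈ps =
    p ∷ ys ∷ʳ w , s≤s (2≤ ys) , Unique-++⁻ˡ (h ∷ p ∷ ys ∷ʳ w) (subst (λ xs → Unique (h ∷ p ∷ xs)) (sym (∷ʳ-++ ys w zs)) !path) , cut path
    where
    2≤ : ∀ ys → 1 ≤ length (ys ∷ʳ w)
    2≤ []      = s≤s z≤n
    2≤ (_ ∷ _) = s≤s z≤n
    cut : Linked _~_ (h ∷ p ∷ ys ++ w ∷ zs) → Linked _~_ (h ∷ (p ∷ ys ∷ʳ w) ∷ʳ h)
    cut (h~p ∷ path) = h~p ∷ Linked-cut ys path (~-sym h~w)

  -- A path that can always be prolonged without turning back meets itself.
  minDegree-2⇒cycle : ∀ {xs x} → Unique xs → All (λ v → 2 ≤ degreeIn xs v) xs → x ∈ xs → ∃₂ (IsCycle G)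
  minDegree-2⇒cycle {xs} {x} !xs 2≤d x∈xs = prolong n [] ([] ∷ []) [-] x∈xs (m<n+m n (s≤s z≤n))
    where
    -- The last hypothesis makes the path longer than `n` once the fuel is spent, which the
    -- pigeonhole principle rules out for distinct vertices.
    prolong : ∀ fuel {h} ps → Unique (h ∷ ps) → Linked _~_ (h ∷ ps) → h ∈ xs → n < length (h ∷ ps) + fuel → ∃₂ (IsCycle G)
    prolong zero    ps !path _ _ long =
      contradiction (Unique-length-≤ !path) (<⇒≱ (subst (n <_) (+-identityʳ _) long))
    -- A path of one vertex has no previous vertex; asking for a neighbour other than `h` itself
    -- yields the inequality that keeps the path repetition-free.
    prolong (suc fuel) {h} [] !path path h∈xs long with w , w∈xs , h~w , w≢h ← neighbour-≢ !xs (All.lookup 2≤d h∈xs) h =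
      prolong fuel [ h ] ((w≢h ∷ []) ∷ !path) (~-sym h~w ∷ path) w∈xs (subst (n <_) (+-suc 1 fuel) long)
    prolong (suc fuel) {h} (p ∷ ps) !path path h∈xs long with w , w∈xs , h~w , w≢p ← neighbour-≢ !xs (All.lookup 2≤d h∈xs) p
      with w ∈? (h ∷ p ∷ ps)
    ... | yes (here refl)          = contradiction h~w (~-irrefl h)
    ... | yes (there (here w≡p))   = contradiction w≡p w≢p
    ... | yes (there (there w∈ps)) = h , chord⇒cycle !path path w∈ps h~w
    ... | no w∉path                = prolong fuel (h ∷ p ∷ ps) (All.¬Any⇒All¬ _ w∉path ∷ !path) (~-sym h~w ∷ path) w∈xs
                                       (subst (n <_) (+-suc (length (h ∷ p ∷ ps)) fuel) long)

  -- Induction on the number of vertices: without a cycle, some `v` in `xs` has at most one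
  -- neighbour in `xs`, and deleting it lowers the degree sum by at most 2.
  degreeSum-≤ : Acyclic G → ∀ ℓ {xs} → Unique xs → length xs ≡ suc ℓ → degreeSum xs ≤ 2 * ℓ
  degreeSum-≤ acyclic ℓ {xs@(x ∷ _)} !xs |xs|≡ with All.all? (λ v → 2 ≤? degreeIn xs v) xs
  ... | yes 2≤d = let u , vs , cycle = minDegree-2⇒cycle !xs 2≤d (here refl) in contradiction cycle (acyclic u vs)
  ... | no ¬2≤d with v , v∈xs , d≱2 ← find (All.¬All⇒Any¬ (λ v → 2 ≤? degreeIn xs v) xs ¬2≤d)
    with ws , p ← ∈⇒↭ v∈xs
    with _ ∷ !ws ← Unique-resp-↭ p !xs = begin
      degreeSum xs                       ≡⟨ degreeSum-↭ p ⟩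
      degreeSum (v ∷ ws)                 ≡⟨ degreeSum-∷ v ws ⟩
      2 * degreeIn ws v + degreeSum ws   ≤⟨ rest ℓ ws !ws (suc-injective (trans (sym (↭-length p)) |xs|≡)) d≤1 ⟩
      2 * ℓ                              ∎
    where
    open ≤-Reasoning
    d≤1 : degreeIn ws v ≤ 1
    d≤1 = subst (_≤ 1) (trans (degreeIn-↭ p v) (degreeIn-∷-self v ws)) (s≤s⁻¹ (≰⇒> d≱2))
    rest : ∀ ℓ ws → Unique ws → length ws ≡ ℓ → degreeIn ws v ≤ 1 → 2 * degreeIn ws v + degreeSum ws ≤ 2 * ℓ
    -- The induction hypothesis speaks of nonempty lists, so deleting the only vertex is a case of
    -- its own.
    rest zero    []        _   _     _   = z≤n
    rest (suc ℓ) ws        !ws |ws|≡ d≤1 = subst (2 * degreeIn ws v + degreeSum ws ≤_) (sym (*-suc 2 ℓ))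
      (+-mono-≤ (*-monoʳ-≤ 2 d≤1) (degreeSum-≤ acyclic ℓ !ws |ws|≡))

  sum-degrees-≤ : Acyclic G → sum (degrees G) ≤ 2 * pred n
  sum-degrees-≤ acyclic = go n refl
    where
    go : ∀ n′ → n ≡ n′ → sum (degrees G) ≤ 2 * pred n′
    go zero refl     = z≤n
    go (suc ℓ) refl = degreeSum-≤ acyclic ℓ (Unique.allFin⁺ n) (length-tabulate {n = suc ℓ} (λ v → v))

  -- A walk to another vertex starts with an edge at `v`. Positivity is what lets every degree be
  -- lowered by one without truncation.
  degree-≥1 : Connected G → 2 ≤ n → ∀ v → 1 ≤ degree G v
  degree-≥1 connected 2≤n v = let u , v≢u = other 2≤n v in first (connected v u) v≢u
    where
    other : ∀ {n} → 2 ≤ n → (v : Fin n) → ∃[ u ] v ≢ u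
    other (s≤s (s≤s _)) zero    = suc zero , λ ()
    other (s≤s (s≤s _)) (suc _) = zero , λ ()
    first : ∀ {u} → Star _~_ v u → v ≢ u → 1 ≤ degree G v
    first ε         v≢v = contradiction refl v≢v
    first (v~x ◅ _) _   = ∈-length (∈-filter⁺ (v ~?_) (∈-allFin _) v~x)

-- The product over edges as a product over vertices

module _ {A : Set} where

  product-map-* : ∀ (f g : A → ℕ) xs → product (map (λ x → f x * g x) xs) ≡ product (map f xs) * product (map g xs)
  product-map-* f g []       = refl
  product-map-* f g (x ∷ xs) = trans (cong (f x * g x *_) (product-map-* f g xs)) (interchange (f x) (g x) _ _)
    where
    interchange : ∀ a b c d → a * b * (c * d) ≡ a * c * (b * d)
    interchange = solve-∀

  product-map-const : ∀ x (ys : List A) → product (map (λ _ → x) ys) ≡ x ^ length ys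
  product-map-const x []       = refl
  product-map-const x (_ ∷ ys) = cong (x *_) (product-map-const x ys)

  product-map-filter : ∀ {P : Pred A 0ℓ} (P? : Decidable P) (f : A → ℕ) xs →
    product (map f (filter P? xs)) ≡ product (map (λ x → if does (P? x) then f x else 1) xs)
  product-map-filter P? f []       = refl
  product-map-filter P? f (x ∷ xs) with P? x
  ... | yes _ = cong (f x *_) (product-map-filter P? f xs)
  ... | no _  = trans (product-map-filter P? f xs) (sym (*-identityˡ _))

module _ {A B : Set} where

  product-map-cartesianProduct : ∀ (f : A × B → ℕ) xs ys →
    product (map f (cartesianProduct xs ys)) ≡ product (map (λ x → product (map (λ y → f (x , y)) ys)) xs)
  product-map-cartesianProduct f []       ys = refl
  product-map-cartesianProduct f (x ∷ xs) ys = begin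
    product (map f (map (x ,_) ys ++ cartesianProduct xs ys))
      ≡⟨ cong product (map-++ f (map (x ,_) ys) _) ⟩
    product (map f (map (x ,_) ys) ++ map f (cartesianProduct xs ys))
      ≡⟨ product-++ (map f (map (x ,_) ys)) _ ⟩
    product (map f (map (x ,_) ys)) * product (map f (cartesianProduct xs ys))
      ≡⟨ cong₂ _*_ (cong product (sym (map-∘ ys))) (product-map-cartesianProduct f xs ys) ⟩
    product (map (λ y → f (x , y)) ys) * product (map (λ x → product (map (λ y → f (x , y)) ys)) xs) ∎
    where open ≡-Reasoning

  product-map-comm : ∀ (f : A → B → ℕ) xs ys →
    product (map (λ x → product (map (f x) ys)) xs) ≡ product (map (λ y → product (map (λ x → f x y) xs)) ys)
  product-map-comm f []       ys = sym (trans (product-map-const 1 ys) (^-zeroˡ (length ys)))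
  product-map-comm f (x ∷ xs) ys =
    trans (cong (product (map (f x) ys) *_) (product-map-comm f xs ys)) (sym (product-map-* (f x) _ ys))

module _ {n : ℕ} (G : SimpleGraph n) where
  open SimpleGraph G

  -- Each edge uv contributes the factor d(u) to u and the factor d(v) to v.
  Π₂≡∏d^d : Π₂ G ≡ product (map (λ d → d ^ d) (degrees G))
  Π₂≡∏d^d = begin
    product (map (uncurry λ u v → d u * d v) (edges G))
      -- The filter becomes an indicator factor, so that the product runs over all ordered pairs and
      -- can be rearranged freely.
      ≡⟨ product-map-filter _ _ (cartesianProduct V V) ⟩
    product (map _ (cartesianProduct V V))
      ≡⟨ product-map-cartesianProduct _ V V ⟩
    ∏ (λ u → ∏ λ v → if below u v then d u * d v else 1)
      ≡⟨ ∏-cong (λ u → trans (∏-cong (λ v → split-if u v)) (product-map-* (fst u) (snd u) V)) ⟩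
    ∏ (λ u → ∏ (fst u) * ∏ (snd u))
      ≡⟨ product-map-* (λ u → ∏ (fst u)) (λ u → ∏ (snd u)) V ⟩
    ∏ (λ u → ∏ (fst u)) * ∏ (λ u → ∏ (snd u))
      -- Exchanging the two products over second endpoints turns `d v` into a factor of the outer
      -- vertex, so both kinds of factor meet at the same `u`.
      ≡⟨ cong (∏ (λ u → ∏ (fst u)) *_) (product-map-comm snd V V) ⟩
    ∏ (λ u → ∏ (fst u)) * ∏ (λ u → ∏ λ v → snd v u)
      ≡⟨ product-map-* (λ u → ∏ (fst u)) (λ u → ∏ λ v → snd v u) V ⟨
    ∏ (λ u → ∏ (fst u) * ∏ λ v → snd v u)
      ≡⟨ ∏-cong (λ u → trans (sym (product-map-* (fst u) (λ v → snd v u) V)) (∏-cong (one-order u))) ⟩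
    ∏ (λ u → ∏ λ v → if does (u ~? v) then d u else 1)
      ≡⟨ ∏-cong (λ u → trans (sym (product-map-filter (u ~?_) (λ _ → d u) V)) (product-map-const (d u) (filter (u ~?_) V))) ⟩
    ∏ (λ u → d u ^ d u)
      ≡⟨ cong product (map-∘ V) ⟩
    product (map (λ d → d ^ d) (degrees G)) ∎
    where
    open ≡-Reasoning
    V = allFin n
    d = degree G
    ∏ : (Fin n → ℕ) → ℕ
    ∏ f = product (map f V)
    ∏-cong : ∀ {f g} → (∀ u → f u ≡ g u) → ∏ f ≡ ∏ g
    ∏-cong f≗g = cong product (map-cong f≗g V)
    below : Fin n → Fin n → Bool
    below u v = does (u Fin.<? v) ∧ does (u ~? v)
    fst snd : Fin n → Fin n → ℕ
    fst u v = if below u v then d u else 1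
    snd u v = if below u v then d v else 1

    split-if : ∀ u v → (if below u v then d u * d v else 1) ≡ fst u v * snd u v
    split-if u v with does (u Fin.<? v) ∧ does (u ~? v)
    ... | Bool.true  = refl
    ... | Bool.false = refl

    -- For adjacent vertices exactly one of `u < v` and `v < u` holds, so one factor is `d u` and
    -- the other is 1.
    one-order : ∀ u v → fst u v * snd v u ≡ (if does (u ~? v) then d u else 1)
    one-order u v = decide (u Fin.<? v) (v Fin.<? u) (u ~? v) (v ~? u)
      where
      decide : (u<?v : Dec (u Fin.< v)) (v<?u : Dec (v Fin.< u)) (u~?v : Dec (u ~ v)) (v~?u : Dec (v ~ u)) →
        (if does u<?v ∧ does u~?v then d u else 1) * (if does v<?u ∧ does v~?u then d u else 1)
          ≡ (if does u~?v then d u else 1)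
      decide _         _         (yes u~v) (no v≁u)  = contradiction (~-sym u~v) v≁u
      decide _         _         (no u≁v)  (yes v~u) = contradiction (~-sym v~u) u≁v
      decide (yes _)   (yes _)   (no _)    (no _)    = refl
      decide (yes _)   (no _)    (no _)    (no _)    = refl
      decide (no _)    (yes _)   (no _)    (no _)    = refl
      decide (no _)    (no _)    (no _)    (no _)    = refl
      decide (yes _)   (no _)    (yes _)   (yes _)   = *-identityʳ (d u)
      decide (no _)    (yes _)   (yes _)   (yes _)   = *-identityˡ (d u)
      decide (yes u<v) (yes v<u) (yes _)   (yes _)   = contradiction v<u (Fin.<-asym u<v)
      decide (no u≮v)  (no v≮u)  (yes u~v) (yes _)   with Fin.<-cmp u v
      ... | tri< u<v _ _  = contradiction u<v u≮v
      ... | tri> _ _ v<u  = contradiction v<u v≮u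
      ... | tri≈ _ refl _ = contradiction u~v (~-irrefl u)

-- Products of log-convex weights

-- For positive `e` this is `(1 − 1/(1+e))^m ≥ 1 − m/e` cleared of denominators, slightly weaker
-- than Bernoulli's bound `1 − m/(1+e)`.
bernoulli : ∀ e m → e * suc e ^ m ≤ e * e ^ m + m * suc e ^ m
bernoulli e zero    = m≤m+n (e * 1) 0
bernoulli e (suc m) = begin
  e * (suc e * Q)                                ≡⟨ expand e Q ⟩
  e * Q + e * (e * Q)                            ≤⟨ +-monoʳ-≤ (e * Q) (*-monoʳ-≤ e (bernoulli e m)) ⟩
  e * Q + e * (e * P + m * Q)                    ≤⟨ m≤m+n _ (Q + m * Q) ⟩
  e * Q + e * (e * P + m * Q) + (Q + m * Q)      ≡⟨ collect e m P Q ⟩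
  e * (e * P) + suc m * (suc e * Q)              ∎
  where
  open ≤-Reasoning
  P = e ^ m
  Q = suc e ^ m
  expand : ∀ e Q → e * ((1 + e) * Q) ≡ e * Q + e * (e * Q)
  expand = solve-∀
  collect : ∀ e m P Q → e * Q + e * (e * P + m * Q) + (Q + m * Q) ≡ e * (e * P) + (1 + m) * ((1 + e) * Q)
  collect = solve-∀

-- Shifting by one makes the weight of a leaf w 0 = 1.
w : ℕ → ℕ
w e = suc e ^ suc e

w≢0 : ∀ e → NonZero (w e)
w≢0 e = m^n≢0 (suc e) (suc e)

w-<-suc : ∀ e → w e < w (suc e)
w-<-suc e = <-≤-trans (^-monoˡ-< (suc e) ≤-refl) (m≤n*m (suc (suc e) ^ suc e) (suc (suc e)))

-- The two sides regroup to `(2 + a)² Q` and `(3 + a)² P`. One factor of each square is spent on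
-- `ratio`; the other gives the strict inequality.
w-logConvex : ∀ a → w (suc a) * w (suc a) < w a * w (suc (suc a))
w-logConvex a = begin-strict
  w (suc a) * w (suc a)                                       ≡⟨ regroup (2 + a) ((2 + a) ^ (1 + a)) ⟩
  (2 + a) * (2 + a) * ((2 + a) ^ (1 + a) * (2 + a) ^ (1 + a)) ≡⟨ cong ((2 + a) * (2 + a) *_) (^-distrib-* (2 + a) (2 + a) (1 + a)) ⟨
  (2 + a) * (2 + a) * Q                                       ≡⟨ *-assoc (2 + a) (2 + a) Q ⟩
  (2 + a) * ((2 + a) * Q)                                     ≤⟨ *-monoʳ-≤ (2 + a) ratio ⟩
  (2 + a) * ((3 + a) * P)                                     <⟨ *-monoˡ-< ((3 + a) * P) {{m*n≢0 (3 + a) P}} (n<1+n (2 + a)) ⟩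
  (3 + a) * ((3 + a) * P)                                     ≡⟨ cong (λ x → (3 + a) * ((3 + a) * x)) (^-distrib-* (1 + a) (3 + a) (1 + a)) ⟩
  (3 + a) * ((3 + a) * (w a * (3 + a) ^ (1 + a)))             ≡⟨ regroup′ (3 + a) (w a) ((3 + a) ^ (1 + a)) ⟩
  w a * w (2 + a)                                             ∎
  where
  open ≤-Reasoning
  P = ((1 + a) * (3 + a)) ^ (1 + a)
  Q = ((2 + a) * (2 + a)) ^ (1 + a)
  instance
    P≢0 : NonZero P
    P≢0 = m^n≢0 ((1 + a) * (3 + a)) (1 + a)

  ^-distrib-* : ∀ m n o → (m * n) ^ o ≡ m ^ o * n ^ o
  ^-distrib-* m n zero    = refl
  ^-distrib-* m n (suc o) = trans (cong (m * n *_) (^-distrib-* m n o)) (interchange m n (m ^ o) (n ^ o))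
    where
    interchange : ∀ m n x y → m * n * (x * y) ≡ m * x * (n * y)
    interchange = solve-∀

  regroup : ∀ d x → d * x * (d * x) ≡ d * d * (x * x)
  regroup = solve-∀
  regroup′ : ∀ d x y → d * (d * (x * y)) ≡ x * (d * (d * y))
  regroup′ = solve-∀

  square : ∀ a → 1 + (1 + a) * (3 + a) ≡ (2 + a) * (2 + a)
  square = solve-∀
  lhs : ∀ a Q → (1 + a) * (Q + (2 + a) * Q) ≡ (1 + a) * (3 + a) * Q
  lhs = solve-∀
  rhs : ∀ a P Q → (1 + a) * (3 + a) * P + (1 + a) * Q ≡ (1 + a) * (Q + (3 + a) * P)
  rhs = solve-∀

  -- Bernoulli's inequality for the base (2 + a)² − 1 = (1 + a)(3 + a).
  ratio : (2 + a) * Q ≤ (3 + a) * P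
  ratio = +-cancelˡ-≤ Q _ _ (*-cancelˡ-≤ (1 + a) (begin
    (1 + a) * (Q + (2 + a) * Q)           ≡⟨ lhs a Q ⟩
    (1 + a) * (3 + a) * Q                 ≤⟨ subst (λ s → (1 + a) * (3 + a) * s ^ (1 + a) ≤ (1 + a) * (3 + a) * P + (1 + a) * s ^ (1 + a))
                                                   (square a) (bernoulli ((1 + a) * (3 + a)) (1 + a)) ⟩
    (1 + a) * (3 + a) * P + (1 + a) * Q   ≡⟨ rhs a P Q ⟩
    (1 + a) * (Q + (3 + a) * P)           ∎))

-- The ratios `w (suc e) / w e` increase. The inequality for `t` is multiplied by log-convexity at
-- `b`, and the common factor `w b * w (suc b)` cancels.
w-ratio : ∀ a t → w (suc a) * w (suc t + a) < w a * w (suc (suc t + a))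
w-ratio a zero    = w-logConvex a
w-ratio a (suc t) = *-cancelˡ-< (w b * w (suc b)) _ _ (begin-strict
  w b * w (suc b) * (w (suc a) * w (suc b))             ≡⟨ regroup (w b) (w (suc b)) (w (suc a)) ⟩
  w (suc a) * w b * (w (suc b) * w (suc b))             <⟨ *-mono-< (w-ratio a t) (w-logConvex b) ⟩
  w a * w (suc b) * (w b * w (suc (suc b)))             ≡⟨ regroup′ (w a) (w (suc b)) (w b) (w (suc (suc b))) ⟩
  w b * w (suc b) * (w a * w (suc (suc b)))             ∎)
  where
  open ≤-Reasoning
  b = suc t + a
  regroup : ∀ b c d → b * c * (d * c) ≡ d * b * (c * c)
  regroup = solve-∀
  regroup′ : ∀ a c b d → a * c * (b * d) ≡ b * c * (a * d)
  regroup′ = solve-∀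

-- Both pairs have the same sum, and the one on the right is further apart. First `t` units move
-- onto `b` above the base `suc a ≤ b`; then `w-ratio` moves the last unit, which makes the
-- inequality strict.
w-spread-< : ∀ {a b} t → a < b → w (suc t + a) * w b < w a * w (suc t + b)
w-spread-≤ : ∀ {a b} t → a ≤ b → w (t + a) * w b ≤ w a * w (t + b)

w-spread-< {a} {b} t a<b = begin-strict
  w (suc t + a) * w b         ≡⟨ cong (λ x → w x * w b) (+-suc t a) ⟨
  w (t + suc a) * w b         ≤⟨ w-spread-≤ t a<b ⟩
  w (suc a) * w (t + b)       <⟨ step (≤-trans a<b (m≤n+m b t)) ⟩
  w a * w (suc (t + b))       ∎
  where
  open ≤-Reasoning
  step : ∀ {c} → suc a ≤ c → w (suc a) * w c < w a * w (suc c)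
  step {c} a<c with d , refl ← m≤n⇒∃[o]m+o≡n a<c =
    subst (λ x → w (suc a) * w x < w a * w (suc x)) (cong suc (+-comm d a)) (w-ratio a d)

w-spread-≤ zero a≤b = ≤-refl
w-spread-≤ {a} {b} (suc t) a≤b with m≤n⇒m<n∨m≡n a≤b
... | inj₁ a<b  = <⇒≤ (w-spread-< t a<b)
... | inj₂ refl = ≤-reflexive (*-comm (w (suc t + a)) (w a))


-- Greedy fillings with parts of size at most `m`

sum-replicate : ∀ k x → sum (replicate k x) ≡ k * x
sum-replicate zero    x = refl
sum-replicate (suc k) x = cong (x +_) (sum-replicate k x)

product-replicate : ∀ k x → product (map w (replicate k x)) ≡ w x ^ k
product-replicate zero    x = refl
product-replicate (suc k) x = cong (w x *_) (product-replicate k x)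

product-tops-++ : ∀ k x ys → product (map w (replicate k x ++ ys)) ≡ w x ^ k * product (map w ys)
product-tops-++ k x ys = begin
  product (map w (replicate k x ++ ys))                  ≡⟨ cong product (map-++ w (replicate k x) ys) ⟩
  product (map w (replicate k x) ++ map w ys)            ≡⟨ product-++ (map w (replicate k x)) (map w ys) ⟩
  product (map w (replicate k x)) * product (map w ys)   ≡⟨ cong (_* product (map w ys)) (product-replicate k x) ⟩
  w x ^ k * product (map w ys)                           ∎
  where open ≡-Reasoning

module Greedy (m : ℕ) .{{_ : NonZero m}} where

  -- The remainder is listed even when it is `0`, just as the degree sequence of the theorem always
  -- lists `μ`, which may be `1`.
  parts : ℕ → List ℕ
  parts s = replicate (s / m) m ++ [ s % m ]

  weight : ℕ → ℕ
  weight s = w m ^ (s / m) * w (s % m)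

  module _ {b} (a : ℕ) (b<m : b < m) where

    quotient : (b + a * m) / m ≡ a
    quotient = begin
      (b + a * m) / m        ≡⟨ +-distrib-/-∣ʳ b (divides-refl a) ⟩
      b / m + a * m / m      ≡⟨ cong₂ _+_ (m<n⇒m/n≡0 b<m) (m*n/n≡m a m) ⟩
      a                      ∎
      where open ≡-Reasoning

    remainder : (b + a * m) % m ≡ b
    remainder = trans ([m+kn]%n≡m%n b a m) (m<n⇒m%n≡m b<m)

    weight-form : weight (b + a * m) ≡ w m ^ a * w b
    weight-form = cong₂ (λ x y → w m ^ x * w y) quotient remainder

    parts-form : parts (b + a * m) ≡ replicate a m ++ [ b ]
    parts-form = cong₂ (λ x y → replicate x m ++ [ y ]) quotient remainder

  -- Zeros have weight `w 0 = 1`, so equality of products can determine the entries only up to `c`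
  -- zeros. The permutation is what later identifies the extremal degree sequence.
  Absorb : ℕ → ℕ → Set
  Absorb x s = w x * weight s < weight (x + s)
              ⊎ w x * weight s ≡ weight (x + s) × ∃[ c ] x ∷ parts s ↭ parts (x + s) ++ replicate c 0

  private
    -- Lets each case below name the quotient and remainder before and after, so that no `/` or `%`
    -- has to be computed there.
    absorb-form : ∀ {x b b′} a a′ → b < m → b′ < m → x + (b + a * m) ≡ b′ + a′ * m →
      w x * (w m ^ a * w b) < w m ^ a′ * w b′
        ⊎ w x * (w m ^ a * w b) ≡ w m ^ a′ * w b′
          × ∃[ c ] x ∷ replicate a m ++ [ b ] ↭ (replicate a′ m ++ [ b′ ]) ++ replicate c 0 →
      Absorb x (b + a * m)
    absorb-form a a′ b<m b′<m eq
      rewrite eq | weight-form a b<m | parts-form a b<m | weight-form a′ b′<m | parts-form a′ b′<m = λ c → c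

    x*[y*z]≡y*[x*z] : ∀ x y z → x * (y * z) ≡ y * (x * z)
    x*[y*z]≡y*[x*z] = solve-∀

    scale-< : ∀ {x y u z} a → w x * w y < u * w z → w x * (w m ^ a * w y) < w m ^ a * (u * w z)
    scale-< {x} {y} {u} {z} a lt = begin-strict
      w x * (w m ^ a * w y)   ≡⟨ x*[y*z]≡y*[x*z] (w x) (w m ^ a) (w y) ⟩
      w m ^ a * (w x * w y)   <⟨ *-monoʳ-< (w m ^ a) {{m^n≢0 (w m) a {{w≢0 m}}}} lt ⟩
      w m ^ a * (u * w z)     ∎
      where open ≤-Reasoning

  -- The new entry meets the remainder `b`. If `x + b < m` they merge, with strict gain unless one
  -- of them is `0`. Otherwise they become `m` and the excess, with strict gain unless `x` is
  -- already `m`.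
  absorb-divided : ∀ {x b} a → x ≤ m → b < m → Absorb x (b + a * m)
  absorb-divided {zero} {b} a _ b<m =
    inj₂ (*-identityˡ _ , 1 , ∷↭∷ʳ 0 (parts (b + a * m)))
  absorb-divided {suc x} {b} a x<m b<m with suc x + b <? m
  absorb-divided {suc x} {zero} a x<m b<m | yes x+0<m = absorb-form a a b<m x<m′ refl (inj₂
    ( trans (x*[y*z]≡y*[x*z] (w (suc x)) (w m ^ a) (w 0)) (cong (w m ^ a *_) (*-identityʳ (w (suc x))))
    , 1 , ↭-trans (↭-sym (shift (suc x) (replicate a m) [ 0 ])) (↭-reflexive (sym (++-assoc (replicate a m) _ _)))))
    where x<m′ = subst (_< m) (+-identityʳ (suc x)) x+0<m
  absorb-divided {suc x} {suc b} a x<m b<m | yes x+b<m =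
    absorb-form a a b<m x+b<m (sym (+-assoc (suc x) (suc b) (a * m)))
      (inj₁ (<-≤-trans (scale-< {suc x} {suc b} {1} {suc x + suc b} a strict)
                       (≤-reflexive (cong (w m ^ a *_) (*-identityˡ (w (suc x + suc b)))))))
    where
    strict : w (suc x) * w (suc b) < 1 * w (suc x + suc b)
    -- Merging is the extreme spread, to `0` and the sum; the factor `w 0` computes to `1`.
    strict = subst (λ y → w y * w (suc b) < 1 * w (suc x + suc b)) (+-identityʳ (suc x)) (w-spread-< x (s≤s z≤n))
  absorb-divided {suc x} {b} a x<m b<m | no x+b≮m with o , m+o≡x+b ← m≤n⇒∃[o]m+o≡n (≮⇒≥ x+b≮m) | m≤n⇒m<n∨m≡n x<m
  ... | inj₂ refl = absorb-form a (suc a) b<m b<m (swap-+ (suc x) b (a * m))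
    (inj₂ (sym (*-assoc (w m) (w m ^ a) (w b)) , 0 , ↭-reflexive (sym (++-identityʳ _))))
    where
    swap-+ : ∀ x b y → x + (b + y) ≡ b + (x + y)
    swap-+ = solve-∀
  ... | inj₁ x<m′ = absorb-form a (suc a) b<m (<-trans o<b b<m) total
    (inj₁ (<-≤-trans (scale-< {suc x} {b} {w m} {o} a strict)
       (≤-reflexive (trans (x*[y*z]≡y*[x*z] (w m ^ a) (w m) (w o)) (sym (*-assoc (w m) (w m ^ a) (w o)))))))
    where
    o<b : o < b
    o<b = +-cancelˡ-< m _ _ (subst (_< m + b) (sym m+o≡x+b) (+-monoˡ-< b x<m′))
    total : suc x + (b + a * m) ≡ o + (m + a * m)
    total = trans (sym (+-assoc (suc x) b (a * m))) (trans (cong (_+ a * m) (trans (sym m+o≡x+b) (+-comm m o))) (+-assoc o m (a * m)))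
    strict : w (suc x) * w b < w m * w o
    -- Here `m` is `suc b + t`, hence `suc x` is `suc t + o`: moving `suc t` units onto `b` fills it
    -- up to `m` and leaves `o`.
    strict with t , refl ← m≤n⇒∃[o]m+o≡n b<m = subst₂ _<_
      (cong (λ y → w y * w b) (+-cancelʳ-≡ b _ _ (trans (permute t o b) m+o≡x+b)))
      (trans (*-comm (w o) _) (cong (λ y → w (suc y) * w o) (+-comm t b)))
      (w-spread-< t o<b)
      where
      permute : ∀ t o b → 1 + t + o + b ≡ 1 + b + t + o
      permute = solve-∀

  absorb : ∀ {x} s → x ≤ m → Absorb x s
  absorb {x} s x≤m = subst (Absorb x) (sym (m≡m%n+[m/n]*n s m)) (absorb-divided (s / m) x≤m (m%n<n s m))

  -- The extra 0 makes room for the remainder entry of parts, which is present even when it is 0.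
  product-dichotomy : ∀ {xs} → All (_≤ m) xs →
    product (map w xs) < weight (sum xs)
    ⊎ product (map w xs) ≡ weight (sum xs) × ∃[ c ] 0 ∷ xs ↭ parts (sum xs) ++ replicate c 0
  product-dichotomy []               = inj₂ (sym (weight-form 0 (>-nonZero⁻¹ m)) , 0 , ↭-reflexive (sym (cong (_++ []) (parts-form 0 (>-nonZero⁻¹ m)))))
  product-dichotomy {x ∷ xs} (x≤m ∷ xs≤m) with product-dichotomy xs≤m | absorb (sum xs) x≤m
  ... | inj₁ lt       | inj₁ lt′        = inj₁ (<-trans (*-monoʳ-< (w x) {{w≢0 x}} lt) lt′)
  ... | inj₁ lt       | inj₂ (eq′ , _)  = inj₁ (<-≤-trans (*-monoʳ-< (w x) {{w≢0 x}} lt) (≤-reflexive eq′))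
  ... | inj₂ (eq , _) | inj₁ lt′        = inj₁ (≤-<-trans (≤-reflexive (cong (w x *_) eq)) lt′)
  ... | inj₂ (eq , c , p) | inj₂ (eq′ , c′ , p′) = inj₂ (trans (cong (w x *_) eq) eq′ , c′ + c , (begin
    0 ∷ x ∷ xs                                               ↭⟨ swap 0 x ↭-refl ⟩
    x ∷ 0 ∷ xs                                               ↭⟨ prep x p ⟩
    x ∷ parts (sum xs) ++ replicate c 0                      ↭⟨ ++⁺ʳ (replicate c 0) p′ ⟩
    (parts (x + sum xs) ++ replicate c′ 0) ++ replicate c 0  ≡⟨ ++-assoc (parts (x + sum xs)) _ _ ⟩
    parts (x + sum xs) ++ replicate c′ 0 ++ replicate c 0    ≡⟨ cong (parts (x + sum xs) ++_) (replicate-+ c′ c) ⟨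
    parts (x + sum xs) ++ replicate (c′ + c) 0               ∎))
    where
    open PermutationReasoning
    replicate-+ : ∀ i j → replicate (i + j) 0 ≡ replicate i 0 ++ replicate j 0
    replicate-+ zero    j = refl
    replicate-+ (suc i) j = cong (0 ∷_) (replicate-+ i j)

  -- An extra entry `1` multiplies the product by `w 1 > 1`, and absorbing that entry into the
  -- filling loses nothing.
  weight-<-suc : ∀ s → weight s < weight (suc s)
  weight-<-suc s = begin-strict
    weight s         ≡⟨ *-identityˡ (weight s) ⟨
    1 * weight s     <⟨ *-monoˡ-< (weight s) {{weight≢0}} (w-<-suc 0) ⟩
    w 1 * weight s   ≤⟨ merge-≤ ⟩
    weight (suc s)   ∎
    where
    open ≤-Reasoning
    weight≢0 : NonZero (weight s)
    weight≢0 = m*n≢0 (w m ^ (s / m)) (w (s % m)) {{m^n≢0 (w m) (s / m) {{w≢0 m}}}} {{w≢0 (s % m)}}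
    merge-≤ : w 1 * weight s ≤ weight (suc s)
    merge-≤ with absorb {1} s (>-nonZero⁻¹ m)
    ... | inj₁ lt       = <⇒≤ lt
    ... | inj₂ (eq , _) = ≤-reflexive eq

  weight-mono-< : ∀ {s t} → s < t → weight s < weight t
  weight-mono-< {s} s<t with u , refl ← m≤n⇒∃[o]m+o≡n s<t = go u
    where
    go : ∀ u → weight s < weight (suc s + u)
    go zero    = subst (λ v → weight s < weight (suc v)) (sym (+-identityʳ s)) (weight-<-suc s)
    go (suc u) = <-trans (go u) (subst (λ v → weight (suc s + u) < weight (suc v)) (sym (+-suc s u)) (weight-<-suc (suc s + u)))

  weight-mono-≤ : ∀ {s t} → s ≤ t → weight s ≤ weight t
  weight-mono-≤ s≤t with m≤n⇒m<n∨m≡n s≤t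
  ... | inj₁ s<t  = <⇒≤ (weight-mono-< s<t)
  ... | inj₂ refl = ≤-refl

  -- For `s = b + a * m`, the filling of `suc m + s` has `suc a` parts `m` and a remainder `suc b`.
  -- Spreading one pair `m`, `suc b` to `suc m`, `b` is a strict gain because `b < m`.
  weight-top : ∀ s → weight (suc m + s) < w (suc m) * weight s
  weight-top s = subst (λ s → weight (suc m + s) < w (suc m) * weight s) (sym (m≡m%n+[m/n]*n s m)) (divided (s / m) (m%n<n s m))
    where
    exchange : ∀ {b} → b < m → w m * w (suc b) < w (suc m) * w b
    exchange {b} b<m = subst₂ _<_ (*-comm (w (suc b)) (w m)) (*-comm (w b) (w (suc m))) (w-spread-< 0 b<m)

    bound : ∀ {b} a → b < m → w m ^ suc a * w (suc b) < w (suc m) * (w m ^ a * w b)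
    bound {b} a b<m = begin-strict
      w m * w m ^ a * w (suc b)      ≡⟨ rearrange (w m) (w m ^ a) (w (suc b)) ⟩
      w m ^ a * (w m * w (suc b))    <⟨ *-monoʳ-< (w m ^ a) {{m^n≢0 (w m) a {{w≢0 m}}}} (exchange b<m) ⟩
      w m ^ a * (w (suc m) * w b)    ≡⟨ x*[y*z]≡y*[x*z] (w m ^ a) (w (suc m)) (w b) ⟩
      w (suc m) * (w m ^ a * w b)    ∎
      where
      open ≤-Reasoning
      rearrange : ∀ x y z → x * y * z ≡ y * (x * z)
      rearrange = solve-∀

    divided : ∀ {b} a → b < m → weight (suc m + (b + a * m)) < w (suc m) * weight (b + a * m)
    divided {b} a b<m rewrite weight-form a b<m with m≤n⇒m<n∨m≡n b<m
    ... | inj₁ 1+b<m = subst (_< w (suc m) * (w m ^ a * w b))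
      (sym (trans (cong weight (shift-+ m b (a * m))) (weight-form (suc a) 1+b<m)))
      (bound a b<m)
      where
      shift-+ : ∀ m b y → 1 + m + (b + y) ≡ 1 + b + (m + y)
      shift-+ = solve-∀
    -- When `suc b` equals `m` it counts as a further full part: the quotient is `a + 2` and the
    -- remainder `0`.
    ... | inj₂ refl = subst (_< w (suc m) * (w m ^ a * w b))
      (sym (trans (cong weight (shift-+ b (a * m))) (trans (weight-form (suc (suc a)) (>-nonZero⁻¹ m)) (last (w m) (w m ^ a)))))
      (bound a b<m)
      where
      shift-+ : ∀ b y → 1 + (1 + b) + (b + y) ≡ 0 + (1 + b + (1 + b + y))
      shift-+ = solve-∀
      last : ∀ x y → x * (x * y) * 1 ≡ x * y * x
      last = solve-∀

  weight-tops-≤ : ∀ k s → weight (k * suc m + s) ≤ w (suc m) ^ k * weight s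
  weight-tops-≤ zero    s = ≤-reflexive (sym (*-identityˡ (weight s)))
  weight-tops-≤ (suc k) s = begin
    weight (suc m + k * suc m + s)            ≡⟨ cong weight (+-assoc (suc m) (k * suc m) s) ⟩
    weight (suc m + (k * suc m + s))          <⟨ weight-top (k * suc m + s) ⟩
    w (suc m) * weight (k * suc m + s)        ≤⟨ *-monoʳ-≤ (w (suc m)) (weight-tops-≤ k s) ⟩
    w (suc m) * (w (suc m) ^ k * weight s)    ≡⟨ *-assoc (w (suc m)) _ _ ⟨
    w (suc m) * w (suc m) ^ k * weight s      ∎
    where open ≤-Reasoning

  -- The first exchange is already strict. This is what keeps a smaller maximum degree from
  -- attaining the bound.
  weight-tops-< : ∀ k s .{{_ : NonZero k}} → weight (k * suc m + s) < w (suc m) ^ k * weight s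
  weight-tops-< (suc k) s = begin-strict
    weight (suc m + k * suc m + s)            ≡⟨ cong weight (+-assoc (suc m) (k * suc m) s) ⟩
    weight (suc m + (k * suc m + s))          <⟨ weight-top (k * suc m + s) ⟩
    w (suc m) * weight (k * suc m + s)        ≤⟨ *-monoʳ-≤ (w (suc m)) (weight-tops-≤ k s) ⟩
    w (suc m) * (w (suc m) ^ k * weight s)    ≡⟨ *-assoc (w (suc m)) _ _ ⟨
    w (suc m) * w (suc m) ^ k * weight s      ∎
    where open ≤-Reasoning

  product-≤-weight : ∀ {xs} → All (_≤ m) xs → product (map w xs) ≤ weight (sum xs)
  product-≤-weight xs≤m with product-dichotomy xs≤m
  ... | inj₁ lt       = <⇒≤ lt
  ... | inj₂ (eq , _) = ≤-reflexive eq

  -- `M` is the lowered maximum degree and `ys` the remaining entries. Since `r < k`, the total has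
  -- no room for `k` entries above `suc m`, which leaves the cases `M ≤ m` and `M ≡ suc m`.
  extremal : ∀ {k M r ys} .{{_ : NonZero k}} → r < k → All (_< M) ys → k * M + sum ys ≤ k * suc m + r →
    w M ^ k * product (map w ys) < w (suc m) ^ k * weight r
    ⊎ M ≡ suc m × w M ^ k * product (map w ys) ≡ w (suc m) ^ k * weight r
      × ∃[ c ] 0 ∷ ys ↭ parts r ++ replicate c 0
  extremal {k} {M} {r} {ys} r<k ys<M total with m≤n⇒m<n∨m≡n M≤1+m
    where
    M≤1+m : M ≤ suc m
    M≤1+m = s≤s⁻¹ (*-cancelˡ-< k M (2 + m) (begin-strict
      k * M               ≤⟨ m≤m+n (k * M) (sum ys) ⟩
      k * M + sum ys      ≤⟨ total ⟩
      k * suc m + r       <⟨ +-monoʳ-< (k * suc m) r<k ⟩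
      k * suc m + k       ≡⟨ trans (+-comm (k * suc m) k) (sym (*-suc k (suc m))) ⟩
      k * (2 + m)         ∎))
      where open ≤-Reasoning
  -- The tops are themselves at most `m`, so they join `ys` in one greedy comparison before `k`
  -- entries `suc m` are split off.
  ... | inj₁ (s≤s M≤m) = inj₁ (begin-strict
    w M ^ k * product (map w ys)                     ≡⟨ product-tops-++ k M ys ⟨
    product (map w (tops ++ ys))                     ≤⟨ product-≤-weight (All.++⁺ (All.replicate⁺ k M≤m) (All.map (λ y<M → ≤-trans (<⇒≤ y<M) M≤m) ys<M)) ⟩
    weight (sum (tops ++ ys))                        ≡⟨ cong weight (trans (sum-++ tops ys) (cong (_+ sum ys) (sum-replicate k M))) ⟩
    weight (k * M + sum ys)                          ≤⟨ weight-mono-≤ total ⟩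
    weight (k * suc m + r)                           <⟨ weight-tops-< k r ⟩
    w (suc m) ^ k * weight r                         ∎)
    where
    open ≤-Reasoning
    tops = replicate k M
  ... | inj₂ refl = conclude (product-dichotomy (All.map s≤s⁻¹ ys<M)) (m≤n⇒m<n∨m≡n (+-cancelˡ-≤ (k * suc m) _ _ total))
    where
    factor≢0 : NonZero (w (suc m) ^ k)
    factor≢0 = m^n≢0 _ k {{w≢0 (suc m)}}
    -- Strictness has two sources, a sum below `r` and a filling of `ys` that is not greedy;
    -- equality survives only when both are absent.
    conclude :
      product (map w ys) < weight (sum ys)
        ⊎ product (map w ys) ≡ weight (sum ys) × ∃[ c ] 0 ∷ ys ↭ parts (sum ys) ++ replicate c 0 →
      sum ys < r ⊎ sum ys ≡ r →
      _
    conclude (inj₁ lt)             (inj₁ lt′)  = inj₁ (*-monoʳ-< _ {{factor≢0}} (<-trans lt (weight-mono-< lt′)))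
    conclude (inj₁ lt)             (inj₂ refl) = inj₁ (*-monoʳ-< _ {{factor≢0}} lt)
    conclude (inj₂ (eq , _))       (inj₁ lt′)  = inj₁ (*-monoʳ-< _ {{factor≢0}} (≤-<-trans (≤-reflexive eq) (weight-mono-< lt′)))
    conclude (inj₂ (eq , c , ys↭)) (inj₂ refl) = inj₂ (refl , cong (w (suc m) ^ k *_) eq , c , ys↭)

-- Trees with k vertices of maximum degree

filter-split-↭ : ∀ {A : Set} {P : Pred A 0ℓ} (P? : Decidable P) xs → xs ↭ filter P? xs ++ filter (∁? P?) xs
filter-split-↭ {A} P? xs = subst (λ (ys , zs) → xs ↭ ys ++ zs) (partition-defn P? xs)
  (↭ₛ⇒↭ (↭ₛ.partition-↭ (setoid A) P? xs))

sum-map-suc : ∀ xs → sum (map suc xs) ≡ length xs + sum xs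
sum-map-suc []       = refl
sum-map-suc (x ∷ xs) = cong suc (trans (cong (x +_) (sum-map-suc xs)) (swap-+ x (length xs) (sum xs)))
  where
  swap-+ : ∀ x l s → x + (l + s) ≡ l + (x + s)
  swap-+ = solve-∀

map-constant : ∀ {A : Set} (f : A → ℕ) {c xs} → All (λ x → f x ≡ c) xs → map f xs ≡ replicate (length xs) c
map-constant f []           = refl
map-constant f (eq ∷ eqs) = cong₂ _∷_ eq (map-constant f eqs)

-- Here the tree structure enters: acyclicity through the degree sum, connectedness through positive
-- degrees. The extremal argument then concerns lists only.
degrees-profile : ∀ {n k} → 2 ≤ n → (T : 𝒯 n k) → ∃₂ λ M ys →
  degrees (𝒯.graph T) ↭ map suc (replicate k M ++ ys) × All (_< M) ys × k * M + sum ys ≤ n ∸ 2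
degrees-profile {n} {k} 2≤n T = M , ys , degrees↭ , ys<M , +-cancelˡ-≤ n _ _ (≤-trans total (≤-reflexive (2*pred 2≤n)))
  where
  open 𝒯 T renaming (graph to G)
  connected = proj₁ isTree
  acyclic   = proj₂ isTree
  open Forest G
  V = allFin n
  D = maxDegree G
  M = pred D
  top? = λ v → degree G v ≟ D
  e : Fin n → ℕ
  e = pred ∘ degree G
  ys = map e (filter (∁? top?) V)

  suc-e : ∀ v → suc (e v) ≡ degree G v
  suc-e v = suc-pred (degree G v) {{>-nonZero (degree-≥1 connected 2≤n v)}}

  tops : map e (filter top? V) ≡ replicate k M
  tops = trans (map-constant e (All.map (cong pred) (All.all-filter top? V))) (cong (λ l → replicate l M) #maxDegree)

  degree≤D : All (λ v → degree G v ≤ D) V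
  degree≤D = All.map⁻ (xs≤max 0 (degrees G))

  ys<M : All (_< M) ys
  ys<M = All.map⁺ (All.zipWith (λ {v} (d≤D , d≢D) → subst (_≤ pred D) (sym (suc-e v)) (<⇒≤pred (≤∧≢⇒< d≤D d≢D)))
    (All.filter⁺ (∁? top?) degree≤D , All.all-filter (∁? top?) V))

  degrees↭ : degrees G ↭ map suc (replicate k M ++ ys)
  degrees↭ = begin
    degrees G                                             ≡⟨ map-cong (sym ∘ suc-e) V ⟩
    map (λ v → suc (e v)) V                                      ≡⟨ map-∘ V ⟩
    map suc (map e V)                                     ↭⟨ ↭.map⁺ suc (↭.map⁺ e (filter-split-↭ top? V)) ⟩
    map suc (map e (filter top? V ++ filter (∁? top?) V)) ≡⟨ cong (map suc) (trans (map-++ e (filter top? V) _) (cong (_++ ys) tops)) ⟩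
    map suc (replicate k M ++ ys)                         ∎
    where open PermutationReasoning

  -- The `n` on the left collects the units restored by `map suc`; it cancels against
  -- `2 * pred n = n + (n ∸ 2)`.
  total : n + (k * M + sum ys) ≤ 2 * pred n
  total = begin
    n + (k * M + sum ys)                                   ≡⟨ cong₂ _+_ (sym len) (sym sum≡) ⟩
    length (replicate k M ++ ys) + sum (replicate k M ++ ys) ≡⟨ sum-map-suc (replicate k M ++ ys) ⟨
    sum (map suc (replicate k M ++ ys))                    ≡⟨ sum-↭ degrees↭ ⟨
    sum (degrees G)                                        ≤⟨ sum-degrees-≤ acyclic ⟩
    2 * pred n                                             ∎
    where
    open ≤-Reasoning
    len : length (replicate k M ++ ys) ≡ n
    len = trans (sym (length-map suc (replicate k M ++ ys))) (trans (sym (↭-length degrees↭))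
            (trans (length-map (degree G) V) (length-tabulate {n = n} (λ v → v))))
    sum≡ : sum (replicate k M ++ ys) ≡ k * M + sum ys
    sum≡ = trans (sum-++ (replicate k M) ys) (cong (_+ sum ys) (sum-replicate k M))

  2*pred : ∀ {n} → 2 ≤ n → 2 * pred n ≡ n + (n ∸ 2)
  2*pred (s≤s (s≤s {n = l} _)) = double l
    where
    double : ∀ l → 2 * (1 + l) ≡ 2 + l + l
    double = solve-∀

replicate-++⁺ : ∀ k {x ys} → All (_≤ x) ys → AllPairs _≥_ ys → AllPairs _≥_ (replicate k x ++ ys)
replicate-++⁺ zero    _    ys↘ = ys↘
replicate-++⁺ (suc k) ys≤x ys↘ = All.++⁺ (All.replicate⁺ k ≤-refl) ys≤x ∷ replicate-++⁺ k ys≤x ys↘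

-- Sorted lists that are permutations of each other coincide, so identifying a degree sequence
-- reduces to giving a permutation.
degreeSequence-unique : ∀ {n} (G : SimpleGraph n) {xs} → AllPairs _≥_ xs → degrees G ↭ xs → degreeSequence G ≡ xs
degreeSequence-unique G xs↘ degrees↭xs = Pointwise-≡⇒≡
  (Sorted.↗↭↗⇒≋ totalOrder (sort-↗ (degrees G)) (Linked.AllPairs⇒Linked xs↘) (↭⇒↭ₛ (↭-trans (sort-↭ (degrees G)) degrees↭xs)))
  where
  open Data.List.Sort (Flip.decTotalOrder ≤-decTotalOrder)
  totalOrder = Flip.totalOrder ≤-totalOrder

Π₂-↭ : ∀ {n} (G : SimpleGraph n) {xs} → degrees G ↭ map suc xs → Π₂ G ≡ product (map w xs)
Π₂-↭ G {xs} degrees↭ = trans (Π₂≡∏d^d G) (trans (product-↭ (↭.map⁺ (λ d → d ^ d) degrees↭)) (cong product (sym (map-∘ xs))))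

theorem4p2 : (n k : ℕ) (1≤k : 1 ≤ k) (2k+2≤n : 2 * (k + 1) ≤ n) (T : 𝒯 n k) →
  let open Parameters n k 1≤k 2k+2≤n
      G = 𝒯.graph T
      bound = Δ ^ (k * Δ) * (Δ ∸ 1) ^ (p * (Δ ∸ 1)) * μ ^ μ
  in (Π₂ G ≤ bound)
     × (Π₂ G ≡ bound
          ⇔ degreeSequence G ≡ replicate k Δ ++ replicate p (Δ ∸ 1) ++ μ ∷ replicate (n ∸ k ∸ p ∸ 1) 1)
theorem4p2 n k 1≤k 2k+2≤n T = conclude (degrees-profile 2≤n T)
  where
  open Parameters n k 1≤k 2k+2≤n
  G = 𝒯.graph T
  bound = Δ ^ (k * Δ) * (Δ ∸ 1) ^ (p * (Δ ∸ 1)) * μ ^ μ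
  z = n ∸ k ∸ p ∸ 1
  target = replicate k Δ ++ replicate p (Δ ∸ 1) ++ μ ∷ replicate z 1
  -- After lowering by one, the degrees `Δ` and `Δ ∸ 1` become `suc m` and `m`. As `Δ ∸ 1` is the
  -- quotient of `n ∸ 2` by `k`, `r` is the remainder, and `p` is `r / m`.
  m = Δ ∸ 2
  r = n ∸ 2 ∸ k * (Δ ∸ 1)
  open Greedy m

  instance
    k≢0 : NonZero k
    k≢0 = >-nonZero 1≤k

  2≤n : 2 ≤ n
  2≤n = ≤-trans (*-monoʳ-≤ 2 (m≤n+m 1 k)) 2k+2≤n

  q = (n ∸ 2) / k

  Δ≡2+m : Δ ≡ 2 + m
  Δ≡2+m = sym (m+[n∸m]≡n {2} {Δ} (<⇒≤ (m∸n≢0⇒n<m (≢-nonZero⁻¹ m))))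

  Δ∸1≡q : Δ ∸ 1 ≡ q
  Δ∸1≡q = m+n∸n≡m q 1

  Δ∸1≡1+m : Δ ∸ 1 ≡ suc m
  Δ∸1≡1+m = cong (_∸ 1) Δ≡2+m

  k*[Δ∸1]≤n∸2 : k * (Δ ∸ 1) ≤ n ∸ 2
  k*[Δ∸1]≤n∸2 = subst (_≤ n ∸ 2) (trans (*-comm q k) (cong (k *_) (sym Δ∸1≡q))) (m/n*n≤m (n ∸ 2) k)

  r<k : r < k
  r<k = subst (_< k) (trans (m%n≡m∸m/n*n (n ∸ 2) k) (cong (n ∸ 2 ∸_) (trans (*-comm q k) (cong (k *_) (sym Δ∸1≡q)))))
          (m%n<n (n ∸ 2) k)

  n∸2≡ : n ∸ 2 ≡ k * suc m + r
  n∸2≡ = trans (sym (m+[n∸m]≡n k*[Δ∸1]≤n∸2)) (cong (λ x → k * x + r) Δ∸1≡1+m)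

  -- `μ` counts from `n ∸ 1` where `r` counts from `n ∸ 2`; the extra unit passes through both
  -- subtractions because neither truncates.
  μ≡ : μ ≡ suc (r % m)
  μ≡ = begin
    n ∸ 1 ∸ k * (Δ ∸ 1) ∸ p * m          ≡⟨ cong (λ x → x ∸ k * (Δ ∸ 1) ∸ p * m) (+-∸-assoc 1 2≤n) ⟩
    suc (n ∸ 2) ∸ k * (Δ ∸ 1) ∸ p * m    ≡⟨ cong (_∸ p * m) (+-∸-assoc 1 k*[Δ∸1]≤n∸2) ⟩
    suc r ∸ p * m                        ≡⟨ +-∸-assoc 1 (m/n*n≤m r m) ⟩
    suc (r ∸ p * m)                      ≡⟨ cong suc (m%n≡m∸m/n*n r m) ⟨
    suc (r % m)                          ∎
    where open ≡-Reasoning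

  greedy : List ℕ
  greedy = replicate k (suc m) ++ parts r ++ replicate z 0

  target≡ : target ≡ map suc greedy
  target≡ = begin
    target
      ≡⟨ cong₂ _++_ (cong (replicate k) Δ≡2+m) (cong₂ (λ x y → replicate p x ++ y ∷ replicate z 1) Δ∸1≡1+m μ≡) ⟩
    replicate k (2 + m) ++ replicate p (suc m) ++ suc (r % m) ∷ replicate z 1
      ≡⟨ cong₂ _++_ (map-replicate suc k (suc m)) (cong₂ _++_ (map-replicate suc p m) (cong (suc (r % m) ∷_) (map-replicate suc z 0))) ⟨
    map suc (replicate k (suc m)) ++ map suc (replicate p m) ++ map suc (r % m ∷ replicate z 0)
      ≡⟨ cong (map suc (replicate k (suc m)) ++_) (map-++ suc (replicate p m) _) ⟨
    map suc (replicate k (suc m)) ++ map suc (replicate p m ++ r % m ∷ replicate z 0)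
      ≡⟨ map-++ suc (replicate k (suc m)) _ ⟨
    map suc (replicate k (suc m) ++ replicate p m ++ r % m ∷ replicate z 0)
      ≡⟨ cong (λ xs → map suc (replicate k (suc m) ++ xs)) (++-assoc (replicate p m) [ r % m ] (replicate z 0)) ⟨
    map suc greedy ∎
    where open ≡-Reasoning

  bound≡ : bound ≡ w (suc m) ^ k * weight r
  bound≡ = begin
    bound
      ≡⟨ cong₂ _*_ (cong₂ (λ x y → x ^ (k * x) * y ^ (p * y)) Δ≡2+m Δ∸1≡1+m) (cong (λ x → x ^ x) μ≡) ⟩
    (2 + m) ^ (k * (2 + m)) * suc m ^ (p * suc m) * w (r % m)
      ≡⟨ cong₂ (λ x y → x * y * w (r % m)) (power k (suc m)) (power p m) ⟩
    w (suc m) ^ k * w m ^ p * w (r % m)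
      ≡⟨ *-assoc (w (suc m) ^ k) (w m ^ p) (w (r % m)) ⟩
    w (suc m) ^ k * weight r ∎
    where
    open ≡-Reasoning
    power : ∀ j e → suc e ^ (j * suc e) ≡ w e ^ j
    power j e = trans (cong (suc e ^_) (*-comm j (suc e))) (sym (^-*-assoc (suc e) (suc e) j))

  product-greedy : product (map w greedy) ≡ bound
  product-greedy = trans (product-tops-++ k (suc m) (parts r ++ replicate z 0))
    (trans (cong (w (suc m) ^ k *_) rest) (sym bound≡))
    where
    rest : product (map w (parts r ++ replicate z 0)) ≡ weight r
    rest = begin
      product (map w (parts r ++ replicate z 0))                 ≡⟨ cong (product ∘ map w) (++-assoc (replicate p m) [ r % m ] _) ⟩
      product (map w (replicate p m ++ r % m ∷ replicate z 0))   ≡⟨ product-tops-++ p m (r % m ∷ replicate z 0) ⟩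
      w m ^ p * (w (r % m) * product (map w (replicate z 0)))    ≡⟨ cong (λ x → w m ^ p * (w (r % m) * x)) (trans (product-replicate z 0) (^-zeroˡ z)) ⟩
      w m ^ p * (w (r % m) * 1)                                  ≡⟨ cong (w m ^ p *_) (*-identityʳ (w (r % m))) ⟩
      weight r                                                   ∎
      where open ≡-Reasoning

  target-sorted : AllPairs _≥_ target
  target-sorted = subst (AllPairs _≥_) (sym target≡) (AllPairs.map⁺ (AllPairs.map s≤s
    (replicate-++⁺ k (All.++⁺ (All.++⁺ (All.replicate⁺ p (n≤1+n m)) (m≤n⇒m≤1+n rem≤m ∷ [])) (All.replicate⁺ z z≤n))
      (subst (AllPairs _≥_) (sym (++-assoc (replicate p m) [ r % m ] (replicate z 0)))
        (replicate-++⁺ p (rem≤m ∷ All.replicate⁺ z z≤n) (All.replicate⁺ z z≤n ∷ zeros z))))))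
    where
    rem≤m : r % m ≤ m
    rem≤m = m%n≤n r m
    zeros : ∀ z → AllPairs _≥_ (replicate z 0)
    zeros zero    = []
    zeros (suc z) = All.replicate⁺ z z≤n ∷ zeros z

  -- `Π₂` depends only on the multiset of degrees, so this implication is available before any case
  -- distinction.
  sequence⇒bound : degreeSequence G ≡ target → Π₂ G ≡ bound
  sequence⇒bound eq = trans (Π₂-↭ G {greedy} (↭-trans (↭-sym (sort-↭ (degrees G))) (↭-reflexive (trans eq target≡)))) product-greedy
    where open Data.List.Sort (Flip.decTotalOrder ≤-decTotalOrder) using (sort-↭)

  -- Keeps `z` from truncating: `p ≤ r < k`, while `n` is at least `2k + 2`.
  k+p<n : k + p < n
  k+p<n = begin-strict
    k + p          ≤⟨ +-monoʳ-≤ k (m/n≤m r m) ⟩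
    k + r          <⟨ +-monoʳ-< k r<k ⟩
    k + k          ≤⟨ m≤m+n (k + k) 2 ⟩
    k + k + 2      ≡⟨ double k ⟩
    2 * (k + 1)    ≤⟨ 2k+2≤n ⟩
    n              ∎
    where
    open ≤-Reasoning
    double : ∀ k → k + k + 2 ≡ 2 * (k + 1)
    double = solve-∀

  1+z≡ : suc z ≡ n ∸ (k + p)
  1+z≡ = trans (m+[n∸m]≡n (subst (1 ≤_) (sym (∸-+-assoc n k p)) (m<n⇒0<n∸m k+p<n))) (∸-+-assoc n k p)

  conclude : (∃₂ λ M ys → degrees G ↭ map suc (replicate k M ++ ys) × All (_< M) ys × k * M + sum ys ≤ n ∸ 2) →
    Π₂ G ≤ bound × (Π₂ G ≡ bound ⇔ degreeSequence G ≡ target)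
  conclude (M , ys , degrees↭ , ys<M , total) with extremal r<k ys<M (subst (k * M + sum ys ≤_) n∸2≡ total)
  ... | inj₁ lt = <⇒≤ Π₂<bound , mk⇔ (λ eq → contradiction eq (<⇒≢ Π₂<bound)) sequence⇒bound
    where
    Π₂<bound : Π₂ G < bound
    Π₂<bound = begin-strict
      Π₂ G                                 ≡⟨ trans (Π₂-↭ G degrees↭) (product-tops-++ k M ys) ⟩
      w M ^ k * product (map w ys)         <⟨ lt ⟩
      w (suc m) ^ k * weight r             ≡⟨ bound≡ ⟨
      bound                                ∎
      where open ≤-Reasoning
  ... | inj₂ (refl , eq , c , ys↭) =
    ≤-reflexive Π₂≡bound , mk⇔ (λ _ → degreeSequence-unique G target-sorted degrees↭target) (λ _ → Π₂≡bound)
    where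
    Π₂≡bound : Π₂ G ≡ bound
    Π₂≡bound = trans (Π₂-↭ G degrees↭) (trans (product-tops-++ k M ys) (trans eq (sym bound≡)))

    -- Counting entries gives `k + p + c = n`: the auxiliary `0` in front of `ys` balances the
    -- remainder entry of `parts r`.
    c≡1+z : c ≡ suc z
    c≡1+z = trans (sym (m+n∸m≡n (k + p) c)) (trans (cong (_∸ (k + p)) lengths) (sym 1+z≡))
      where
      open ≡-Reasoning
      lengths : k + p + c ≡ n
      lengths = suc-injective (begin
        suc (k + p + c)                               ≡⟨ regroup k p c ⟩
        k + (p + 1 + c)                               ≡⟨ cong (λ x → k + (x + c)) (trans (length-++ (replicate p m)) (cong (_+ 1) (length-replicate p))) ⟨
        k + (length (parts r) + c)                    ≡⟨ cong (λ x → k + (length (parts r) + x)) (length-replicate c) ⟨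
        k + (length (parts r) + length (replicate c 0)) ≡⟨ cong (k +_) (length-++ (parts r)) ⟨
        k + length (parts r ++ replicate c 0)         ≡⟨ cong (k +_) (↭-length ys↭) ⟨
        k + suc (length ys)                           ≡⟨ +-suc k (length ys) ⟩
        suc (k + length ys)                           ≡⟨ cong suc (trans (length-++ (replicate k M)) (cong (_+ length ys) (length-replicate k))) ⟨
        suc (length (replicate k M ++ ys))            ≡⟨ cong suc (length-map suc (replicate k M ++ ys)) ⟨
        suc (length (map suc (replicate k M ++ ys)))  ≡⟨ cong suc (↭-length degrees↭) ⟨
        suc (length (degrees G))                      ≡⟨ cong suc (trans (length-map (degree G) (allFin n)) (length-tabulate {n = n} (λ v → v))) ⟩
        suc n                                         ∎)
        where
        regroup : ∀ k p c → 1 + (k + p + c) ≡ k + (p + 1 + c)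
        regroup = solve-∀

    degrees↭target : degrees G ↭ target
    degrees↭target = begin
      degrees G                                              ↭⟨ degrees↭ ⟩
      map suc (replicate k M ++ ys)                          ↭⟨ ↭.map⁺ suc (++⁺ˡ (replicate k M) (drop-∷ zero-dropped)) ⟩
      map suc greedy                                         ≡⟨ target≡ ⟨
      target                                                 ∎
      where
      open PermutationReasoning
      -- One of the `suc z` zeros is moved to the front, where it cancels the auxiliary `0`.
      zero-dropped : 0 ∷ ys ↭ 0 ∷ parts r ++ replicate z 0
      zero-dropped = ↭-trans ys↭ (↭-trans (↭-reflexive (cong (λ c → parts r ++ replicate c 0) c≡1+z)) (shift 0 (parts r) (replicate z 0)))
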